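{- For every positive integer $n$, \[ M(3, n) = \begin{cases} 5 & \text{if } n = 3, \\ \lfloor n/3\rfloor & \text{if } n\equiv 0\pmod 3,\ n\neq 3,\\ \lfloor n/3\rfloor + 3 & \text{if } n\equiv 1\pmod 3,\\ \lfloor n/3\rfloor + 2 & \text{if } n\equiv 2\pmod 3. \end{cases} \]
   Context: The $T$-tetromino is the polyomino formed by four unit squares: three in a row together with a fourth square attached to the middle square of that row. A tiling of an $m\times n$ rectangle (of unit cells) by $T$-tetrominos and monominos is a partition of its cells into copies of the $T$-tetromino (in any rotation or reflection, aligned with the grid) and single cells (monominos). The gap number $M(m,n)$ is the least number of monominos occurring in such a tiling of the $m\times n$ rectangle. -}

module Defs where

open import Data.Nat using (ℕ; zero; suc; _+_; _*_; _<_; _≤_)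
open import Data.Nat.Properties using (_≟_)
open import Data.Product using (_×_; _,_; Σ; ∃)
open import Data.List using (List; []; _∷_; concatMap; length; filter)
open import Data.List.Relation.Unary.All using (All)
open import Relation.Binary.PropositionalEquality using (_≡_)
open import Relation.Nullary using (yes; no)

-- A cell of the grid: (row , column), both 0-indexed.
Cell : Set
Cell = ℕ × ℕ

-- The four orientations of the T-tetromino (reflections of a T coincide
-- with rotations, so these are all placements up to translation).
data Orientation : Set where
  down up right left : Orientation

-- A tile: a monomino at a cell, or a T-tetromino with given orientation
-- whose 2x3 / 3x2 bounding box has top-left corner (r , c).
data Tile : Set where
  mono : Cell → Tile
  tee  : Orientation → ℕ → ℕ → Tile

cells : Tile → List Cell
cells (mono x) = x ∷ []
cells (tee down  r c) = (r , c) ∷ (r , suc c) ∷ (r , suc (suc c)) ∷ (suc r , suc c) ∷ []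
cells (tee up    r c) = (suc r , c) ∷ (suc r , suc c) ∷ (suc r , suc (suc c)) ∷ (r , suc c) ∷ []
cells (tee right r c) = (r , c) ∷ (suc r , c) ∷ (suc (suc r) , c) ∷ (suc r , suc c) ∷ []
cells (tee left  r c) = (r , suc c) ∷ (suc r , suc c) ∷ (suc (suc r) , suc c) ∷ (suc r , c) ∷ []

count : Cell → List Cell → ℕ
count x [] = 0
count (i , j) ((a , b) ∷ xs) with i ≟ a | j ≟ b
... | yes _ | yes _ = suc (count (i , j) xs)
... | _     | _     = count (i , j) xs

InRect : ℕ → ℕ → Cell → Set
InRect m n (i , j) = (i < m) × (j < n)

record Tiling (m n : ℕ) : Set where
  field
    tiles    : List Tile
    inside   : All (λ t → All (InRect m n) (cells t)) tiles
    partition : ∀ i j → i < m → j < n → count (i , j) (concatMap cells tiles) ≡ 1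

isMono : Tile → ℕ
isMono (mono _) = 1
isMono (tee _ _ _) = 0

monoCount : List Tile → ℕ
monoCount [] = 0
monoCount (t ∷ ts) = isMono t + monoCount ts

monominos : ∀ {m n} → Tiling m n → ℕ
monominos T = monoCount (Tiling.tiles T)

GapNumberIs : ℕ → ℕ → ℕ → Set
GapNumberIs m n k = (Σ (Tiling m n) λ T → monominos T ≡ k) × (∀ (T : Tiling m n) → k ≤ monominos T)

{-# OPTIONS --safe #-}
-- Every T-tetromino in a strip of height 3 whose bounding box starts in column
-- c covers the cell (1 , c+1), so at most one starts in each column and a
-- tiling is a word whose letters are the tetromino (if any) starting at each
-- column.  A potential depending on two consecutive letters shows that a
-- tiling has at most 2n/3 tetrominoes; since a tiling with t of them has
-- 3n - 4t monominoes, this gives every lower bound except the one for n = 3,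
-- where all tetrominoes share the central cell.  The bounds are attained by
-- the words (d u _)^q _, r (d u _)^q _ and r (d u _)^q l _, where d lies
-- along the top row, u along the bottom row, and r and l stand upright.
module Submission where

open import Defs
open import Data.Fin using (Fin; zero; suc; toℕ; fromℕ<)
import Data.Fin.Properties as Fin
open import Data.Fin.Properties using (toℕ-fromℕ<)
open import Data.List using (List; []; _∷_; _++_; map; concatMap; length)
open import Data.List.Membership.Propositional using (_∈_)
open import Data.List.Membership.Propositional.Properties using (∈-map⁺)
open import Data.List.Properties using (map-++; concatMap-++)
open import Data.List.Relation.Unary.All as All using (All; []; _∷_; all?)
open import Data.List.Relation.Unary.All.Properties using (++⁺; concat⁺; map⁺)
open import Data.List.Relation.Unary.Any using (here; there)
open import Data.Maybe using (Maybe; just; nothing)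
open import Data.Nat using (ℕ; zero; suc; _+_; _*_; _≤_; _<_; z≤n; s≤s; s≤s⁻¹; _%_; _/_; _≤?_)
open import Data.Nat.DivMod using (m≡m%n+[m/n]*n)
open import Data.Nat.Properties
open import Data.Nat.Tactic.RingSolver using (solve-∀)
open import Data.Product using (Σ; _×_; _,_; proj₁; proj₂; ∃)
open import Data.Sum using (inj₁; inj₂)
open import Data.Unit using (⊤; tt)
open import Relation.Binary.PropositionalEquality using (_≡_; _≢_; refl; sym; trans; cong; cong₂; subst; module ≡-Reasoning)
open import Relation.Nullary using (Dec; yes; no; contradiction)
open import Relation.Nullary.Decidable using (_→-dec_; _×-dec_; True; toWitness; from-yes)

-- Counting cells and translating along the strip.

δ : ℕ → ℕ → ℕ
δ zero    zero    = 1
δ zero    (suc _) = 0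
δ (suc _) zero    = 0
δ (suc m) (suc n) = δ m n

δ-refl : ∀ n → δ n n ≡ 1
δ-refl zero    = refl
δ-refl (suc n) = δ-refl n

δ-≢ : ∀ {m n} → m ≢ n → δ m n ≡ 0
δ-≢ {zero}  {zero}  m≢n = contradiction refl m≢n
δ-≢ {zero}  {suc n} m≢n = refl
δ-≢ {suc m} {zero}  m≢n = refl
δ-≢ {suc m} {suc n} m≢n = δ-≢ (λ m≡n → m≢n (cong suc m≡n))

δ-+ : ∀ k m n → δ (m + k) (n + k) ≡ δ m n
δ-+ k zero    zero    = δ-refl k
δ-+ k zero    (suc n) = δ-≢ (λ eq → <⇒≢ (s≤s (m≤n+m k n)) eq)
δ-+ k (suc m) zero    = δ-≢ (λ eq → <⇒≢ (s≤s (m≤n+m k m)) (sym eq))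
δ-+ k (suc m) (suc n) = δ-+ k m n

-- Turns the decisions inside `count` into arithmetic, so that adding, reordering and translating
-- cells reduce to identities about `δ`.
count-∷ : ∀ i j a b xs → count (i , j) ((a , b) ∷ xs) ≡ δ i a * δ j b + count (i , j) xs
count-∷ i j a b xs with i ≟ a | j ≟ b
... | yes refl | yes refl rewrite δ-refl i | δ-refl j = refl
... | yes refl | no j≢b   rewrite δ-≢ j≢b | *-zeroʳ (δ i i) = refl
... | no i≢a   | yes _    rewrite δ-≢ i≢a = refl
... | no i≢a   | no _     rewrite δ-≢ i≢a = refl

count-++ : ∀ x xs ys → count x (xs ++ ys) ≡ count x xs + count x ys
count-++ x [] ys = refl
count-++ (i , j) ((a , b) ∷ xs) ys
  rewrite count-∷ i j a b (xs ++ ys) | count-∷ i j a b xs | count-++ (i , j) xs ys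
  = sym (+-assoc (δ i a * δ j b) _ _)

shiftCell : ℕ → Cell → Cell
shiftCell k (i , j) = i , j + k

shift : ℕ → Tile → Tile
shift k (mono x)    = mono (shiftCell k x)
shift k (tee o r c) = tee o r (c + k)

cells-shift : ∀ k t → cells (shift k t) ≡ map (shiftCell k) (cells t)
cells-shift k (mono x)        = refl
cells-shift k (tee down r c)  = refl
cells-shift k (tee up r c)    = refl
cells-shift k (tee right r c) = refl
cells-shift k (tee left r c)  = refl

concatMap-cells-shift : ∀ k ts →
  concatMap cells (map (shift k) ts) ≡ map (shiftCell k) (concatMap cells ts)
concatMap-cells-shift k [] = refl
concatMap-cells-shift k (t ∷ ts) = trans
  (cong₂ _++_ (cells-shift k t) (concatMap-cells-shift k ts))
  (sym (map-++ (shiftCell k) (cells t) (concatMap cells ts)))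

count-shift : ∀ k i j xs → count (i , j + k) (map (shiftCell k) xs) ≡ count (i , j) xs
count-shift k i j [] = refl
count-shift k i j ((a , b) ∷ xs)
  rewrite count-∷ i (j + k) a (b + k) (map (shiftCell k) xs) | count-∷ i j a b xs
        | δ-+ k j b | count-shift k i j xs = refl

count-shift-< : ∀ {k j} i xs → j < k → count (i , j) (map (shiftCell k) xs) ≡ 0
count-shift-< i [] j<k = refl
count-shift-< {k} {j} i ((a , b) ∷ xs) j<k
  rewrite count-∷ i j a (b + k) (map (shiftCell k) xs)
        | δ-≢ {j} {b + k} (<⇒≢ (<-≤-trans j<k (m≤n+m k b)))
        | *-zeroʳ (δ i a) = count-shift-< i xs j<k

Inside : ℕ → List Tile → Set
Inside n = All (λ t → All (InRect 3 n) (cells t))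

-- Upper bounds

-- A tiling of the 3 × n strip with the cells in pre removed, using k monominoes.
record Partial (n : ℕ) (pre : List Cell) (k : ℕ) : Set where
  field
    tiles  : List Tile
    inside : Inside n tiles
    cover  : ∀ i j → i < 3 → j < n → count (i , j) pre + count (i , j) (concatMap cells tiles) ≡ 1
    monos  : monoCount tiles ≡ k

toTiling : ∀ {n k} → Partial n [] k → Σ (Tiling 3 n) λ T → monominos T ≡ k
toTiling P = record { tiles = tiles ; inside = inside ; partition = cover } , monos
  where open Partial P

addMono : ∀ {n k pre} x → InRect 3 n x → Partial n (x ∷ pre) k → Partial n pre (suc k)
addMono {pre = pre} (a , b) x∈ P = record
  { tiles  = mono (a , b) ∷ tiles
  ; inside = (x∈ ∷ []) ∷ inside
  ; cover  = λ i j i< j< → trans (swap i j) (cover i j i< j<)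
  ; monos  = cong suc monos
  }
  where
  open Partial P
  lemma : ∀ p d c → p + (d + c) ≡ d + p + c
  lemma = solve-∀
  swap : ∀ i j → count (i , j) pre + count (i , j) ((a , b) ∷ concatMap cells tiles)
               ≡ count (i , j) ((a , b) ∷ pre) + count (i , j) (concatMap cells tiles)
  swap i j rewrite count-∷ i j a b (concatMap cells tiles) | count-∷ i j a b pre
    = lemma (count (i , j) pre) (δ i a * δ j b) _

inside-shift : ∀ {n} w {ts} → Inside n ts → Inside (n + w) (map (shift w) ts)
inside-shift w [] = []
inside-shift {n} w {t ∷ ts} (t∈ ∷ ts∈) =
  subst (All (InRect 3 (n + w))) (sym (cells-shift w t))
    (map⁺ (All.map (λ { (i< , j<) → i< , +-monoˡ-< w j< }) t∈))
  ∷ inside-shift w ts∈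

monoCount-shift : ∀ w ts → monoCount (map (shift w) ts) ≡ monoCount ts
monoCount-shift w [] = refl
monoCount-shift w (mono _ ∷ ts) = cong suc (monoCount-shift w ts)
monoCount-shift w (tee _ _ _ ∷ ts) = monoCount-shift w ts

forBelow : ∀ {n} (P : ℕ → Set) → (∀ (i : Fin n) → P (toℕ i)) → ∀ {i} → i < n → P i
forBelow P all i<n = subst P (toℕ-fromℕ< i<n) (all (fromℕ< i<n))

forRect : ∀ {m n} (P : ℕ → ℕ → Set) → (∀ (i : Fin m) (j : Fin n) → P (toℕ i) (toℕ j)) →
  ∀ {i j} → i < m → j < n → P i j
forRect P all {j = j} i<m j<n =
  forBelow (λ i → P i j) (λ i → forBelow (P (toℕ i)) (all i) j<n) i<m

-- The tetrominoes ts fill the first w columns of the strip, apart from pre, and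
-- stick out into the cells pre′ of the remaining columns.
prepend : ∀ {n k pre pre′} w ts → monoCount ts ≡ 0 → Inside (w + n) ts →
  (∀ (i : Fin 3) (j : Fin w) →
    count (toℕ i , toℕ j) pre + count (toℕ i , toℕ j) (concatMap cells ts) ≡ 1) →
  (∀ (i : Fin 3) j →
    count (toℕ i , w + j) pre + count (toℕ i , w + j) (concatMap cells ts) ≡ count (toℕ i , j) pre′) →
  Partial n pre′ k → Partial (w + n) pre k
prepend {n} {k} {pre} {pre′} w ts ts-monos ts-inside fills sticksOut P = record
  { tiles  = ts ++ map (shift w) tiles
  ; inside = ++⁺ ts-inside (subst (λ m → Inside m (map (shift w) tiles)) (+-comm n w) (inside-shift w inside))
  ; cover  = cover′
  ; monos  = monos′
  }
  where
  open Partial P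
  open ≡-Reasoning

  split : ∀ x → count x (concatMap cells (ts ++ map (shift w) tiles))
              ≡ count x (concatMap cells ts) + count x (map (shiftCell w) (concatMap cells tiles))
  split x = begin
    count x (concatMap cells (ts ++ map (shift w) tiles))
      ≡⟨ cong (count x) (concatMap-++ cells ts _) ⟩
    count x (concatMap cells ts ++ concatMap cells (map (shift w) tiles))
      ≡⟨ cong (λ ys → count x (concatMap cells ts ++ ys)) (concatMap-cells-shift w tiles) ⟩
    count x (concatMap cells ts ++ map (shiftCell w) (concatMap cells tiles))
      ≡⟨ count-++ x (concatMap cells ts) _ ⟩
    count x (concatMap cells ts) + count x (map (shiftCell w) (concatMap cells tiles)) ∎

  cover′ : ∀ i j → i < 3 → j < w + n →
    count (i , j) pre + count (i , j) (concatMap cells (ts ++ map (shift w) tiles)) ≡ 1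
  cover′ i j i< j< with <-≤-connex j w
  ... | inj₁ j<w rewrite split (i , j) | count-shift-< i (concatMap cells tiles) j<w
                       | +-identityʳ (count (i , j) (concatMap cells ts)) =
    forRect (λ i j → count (i , j) pre + count (i , j) (concatMap cells ts) ≡ 1) fills i< j<w
  ... | inj₂ w≤j with m≤n⇒∃[o]m+o≡n w≤j
  ...   | j′ , refl = begin
    c + count (i , w + j′) (concatMap cells (ts ++ map (shift w) tiles)) ≡⟨ cong (c +_) (split (i , w + j′)) ⟩
    c + (d + e)                                        ≡⟨ +-assoc c d e ⟨
    c + d + e                                          ≡⟨ cong₂ _+_ sticks e≡ ⟩
    count (i , j′) pre′ + count (i , j′) (concatMap cells tiles) ≡⟨ cover i j′ i< (+-cancelˡ-< w j′ n j<) ⟩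
    1                                                  ∎
    where
    c = count (i , w + j′) pre
    d = count (i , w + j′) (concatMap cells ts)
    sticks : c + d ≡ count (i , j′) pre′
    sticks = forBelow
      (λ i → count (i , w + j′) pre + count (i , w + j′) (concatMap cells ts) ≡ count (i , j′) pre′)
      (λ i → sticksOut i j′) i<
    e = count (i , w + j′) (map (shiftCell w) (concatMap cells tiles))
    e≡ : e ≡ count (i , j′) (concatMap cells tiles)
    e≡ = trans (cong (λ m → count (i , m) (map (shiftCell w) (concatMap cells tiles))) (+-comm w j′))
               (count-shift w i j′ (concatMap cells tiles))

  monoCount-++ : ∀ us vs → monoCount (us ++ vs) ≡ monoCount us + monoCount vs
  monoCount-++ [] vs = refl
  monoCount-++ (u ∷ us) vs = trans (cong (isMono u +_) (monoCount-++ us vs)) (sym (+-assoc (isMono u) _ _))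

  monos′ : monoCount (ts ++ map (shift w) tiles) ≡ k
  monos′ = begin
    monoCount (ts ++ map (shift w) tiles)              ≡⟨ monoCount-++ ts _ ⟩
    monoCount ts + monoCount (map (shift w) tiles)     ≡⟨ cong₂ _+_ ts-monos (monoCount-shift w tiles) ⟩
    monoCount tiles                                    ≡⟨ monos ⟩
    k                                                  ∎

-- Blocks and end pieces of the explicit tilings.

fits? : ∀ n t → Dec (All (InRect 3 n) (cells t))
fits? n t = all? (λ { (i , j) → i <? 3 ×-dec j <? n }) (cells t)

inside? : ∀ n ts → Dec (Inside n ts)
inside? n = all? (fits? n)

covers? : ∀ w pre ts →
  Dec (∀ (i : Fin 3) (j : Fin w) →
    count (toℕ i , toℕ j) pre + count (toℕ i , toℕ j) (concatMap cells ts) ≡ 1)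
covers? w pre ts = Fin.all? (λ i → Fin.all? (λ j → _ ≟ 1))

partial : ∀ n pre ts → {True (inside? n ts)} → {True (covers? n pre ts)} →
  Partial n pre (monoCount ts)
partial n pre ts {ins} {cov} = record
  { tiles  = ts
  ; inside = toWitness ins
  ; cover  = λ i j i< j< →
      forRect (λ i j → count (i , j) pre + count (i , j) (concatMap cells ts) ≡ 1) (toWitness cov) i< j<
  ; monos  = refl
  }

-- The two tetrominoes complete three columns and occupy a single cell of the next one, in the
-- bottom row. A monomino at `(1 , 0)` there recreates the notch the block starts from, so a period
-- costs three columns and one monomino.
block : ∀ {n k} → Partial (suc n) ((2 , 0) ∷ []) k → Partial (4 + n) ((1 , 0) ∷ (2 , 0) ∷ []) k
block {n} = prepend 3 ts refl (from-yes (inside? (4 + n) ts)) (from-yes (covers? 3 ((1 , 0) ∷ (2 , 0) ∷ []) ts))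
  -- What sticks out lies in the first remaining column; separating that column makes every count
  -- compute.
  λ { zero zero → refl ; zero (suc _) → refl ; (suc zero) zero → refl ; (suc zero) (suc _) → refl
    ; (suc (suc zero)) zero → refl ; (suc (suc zero)) (suc _) → refl }
  where ts = tee down 0 0 ∷ tee up 1 1 ∷ []

upright : ∀ {n k} → Partial (suc n) ((1 , 0) ∷ []) k → Partial (2 + n) [] k
upright {n} = prepend 1 ts refl (from-yes (inside? (2 + n) ts)) (from-yes (covers? 1 [] ts))
  λ { zero zero → refl ; zero (suc _) → refl ; (suc zero) zero → refl ; (suc zero) (suc _) → refl
    ; (suc (suc zero)) zero → refl ; (suc (suc zero)) (suc _) → refl }
  where ts = tee right 0 0 ∷ []

fillCentre : ∀ {n k} → Partial (suc n) ((1 , 0) ∷ (2 , 0) ∷ []) k → Partial (suc n) ((2 , 0) ∷ []) (suc k)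
fillCentre = addMono (1 , 0) (from-yes (1 <? 3) , 0<1+n)

fillBottom : ∀ {n k pre} → Partial (suc n) ((2 , 0) ∷ pre) k → Partial (suc n) pre (suc k)
fillBottom = addMono (2 , 0) (from-yes (2 <? 3) , 0<1+n)

swapCells : ∀ {n x y k} → Partial n (x ∷ y ∷ []) k → Partial n (y ∷ x ∷ []) k
swapCells {n} {a , b} {c , d} P = record
  { tiles = tiles ; inside = inside ; monos = monos
  ; cover = λ i j i< j< → trans (cong (_+ _) (swap i j)) (cover i j i< j<) }
  where
  open Partial P
  swap : ∀ i j → count (i , j) ((c , d) ∷ (a , b) ∷ []) ≡ count (i , j) ((a , b) ∷ (c , d) ∷ [])
  swap i j = trans (count-++ (i , j) ((c , d) ∷ []) ((a , b) ∷ []))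
    (trans (+-comm (count (i , j) ((c , d) ∷ [])) _) (sym (count-++ (i , j) ((a , b) ∷ []) ((c , d) ∷ []))))

-- The words (d u _)^q _ and (d u _)^(q+1) l _; what precedes them may cover one
-- of the cells (1 , 0) and (2 , 0).
blunt : ∀ q → Partial (suc (q * 3)) ((1 , 0) ∷ (2 , 0) ∷ []) (suc q)
blunt zero    = partial 1 _ (mono (0 , 0) ∷ [])
blunt (suc q) = block (fillCentre (blunt q))

capped : ∀ q → Partial (2 + suc q * 3) ((1 , 0) ∷ (2 , 0) ∷ []) (suc q)
-- The stem of the closing tetromino takes the cell `(1 , 0)` that otherwise costs a monomino. The
-- cell `(2 , 0)` is taken by the preceding block, so at least one block is present.
capped zero    = block (partial 2 _ (mono (0 , 0) ∷ tee left 0 0 ∷ []))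
capped (suc q) = block (fillCentre (capped q))

-- The stem of the upright tetromino supplies `(1 , 0)` and a monomino supplies `(2 , 0)`; the swap
-- brings the latter to the head of the removed cells, where `addMono` acts.
afterUpright : ∀ {n k} → Partial (suc n) ((1 , 0) ∷ (2 , 0) ∷ []) k → Partial (2 + n) [] (suc k)
afterUpright P = upright (fillBottom (swapCells P))

-- Lower bounds

sumBelow : ℕ → (ℕ → ℕ) → ℕ
sumBelow zero    f = 0
sumBelow (suc n) f = f n + sumBelow n f

sumBelow-≤ : ∀ n {f g} → (∀ {j} → j < n → f j ≤ g j) → sumBelow n f ≤ sumBelow n g
sumBelow-≤ zero    f≤g = z≤n
sumBelow-≤ (suc n) f≤g = +-mono-≤ (f≤g ≤-refl) (sumBelow-≤ n (λ j<n → f≤g (m≤n⇒m≤1+n j<n)))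

sumBelow-cong : ∀ n {f g} → (∀ {j} → j < n → f j ≡ g j) → sumBelow n f ≡ sumBelow n g
sumBelow-cong zero    f≡g = refl
sumBelow-cong (suc n) f≡g = cong₂ _+_ (f≡g ≤-refl) (sumBelow-cong n (λ j<n → f≡g (m≤n⇒m≤1+n j<n)))

sumBelow-const : ∀ n k → sumBelow n (λ _ → k) ≡ n * k
sumBelow-const zero    k = refl
sumBelow-const (suc n) k = cong (k +_) (sumBelow-const n k)

sumBelow-δ-≥ : ∀ {n b} f → n ≤ b → sumBelow n (λ j → δ j b + f j) ≡ sumBelow n f
sumBelow-δ-≥ f n≤b = sumBelow-cong _ λ {j} j<n → cong (_+ f j) (δ-≢ (<⇒≢ (<-≤-trans j<n n≤b)))

sumBelow-δ : ∀ {n b} f → b < n → sumBelow n (λ j → δ j b + f j) ≡ 1 + sumBelow n f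
sumBelow-δ {suc n} {b} f b<1+n with n ≟ b
... | yes refl rewrite δ-refl n | sumBelow-δ-≥ f (≤-refl {n}) = refl
... | no n≢b rewrite δ-≢ n≢b | sumBelow-δ f (≤∧≢⇒< (s≤s⁻¹ b<1+n) (λ b≡n → n≢b (sym b≡n)))
  = +-suc (f n) _

column : List Cell → ℕ → ℕ
column xs j = count (0 , j) xs + (count (1 , j) xs + count (2 , j) xs)

column-∷ : ∀ {a} b xs j → a < 3 → column ((a , b) ∷ xs) j ≡ δ j b + column xs j
column-∷ {a} b xs j a<3
  rewrite count-∷ 0 j a b xs | count-∷ 1 j a b xs | count-∷ 2 j a b xs
  = row a<3
  where
  c₀ = count (0 , j) xs
  c₁ = count (1 , j) xs
  c₂ = count (2 , j) xs
  d = δ j b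
  row : ∀ {a} → a < 3 → δ 0 a * d + c₀ + (δ 1 a * d + c₁ + (δ 2 a * d + c₂)) ≡ d + (c₀ + (c₁ + c₂))
  row {0} _ = l₀ d c₀ c₁ c₂
    where l₀ : ∀ d x y z → d + 0 + x + (y + z) ≡ d + (x + (y + z))
          l₀ = solve-∀
  row {1} _ = l₁ d c₀ c₁ c₂
    where l₁ : ∀ d x y z → x + (d + 0 + y + z) ≡ d + (x + (y + z))
          l₁ = solve-∀
  row {2} _ = l₂ d c₀ c₁ c₂
    where l₂ : ∀ d x y z → x + (y + (d + 0 + z)) ≡ d + (x + (y + z))
          l₂ = solve-∀
  row {suc (suc (suc _))} (s≤s (s≤s (s≤s ())))

-- Each cell inside the strip adds one to exactly one column sum. In a tiling every column sum is 3,
-- which yields `area`.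
sumBelow-column : ∀ {n} xs → All (InRect 3 n) xs → sumBelow n (column xs) ≡ length xs
sumBelow-column {n} [] [] = trans (sumBelow-const n 0) (*-zeroʳ n)
sumBelow-column {n} ((a , b) ∷ xs) ((a<3 , b<n) ∷ xs∈) = begin
  sumBelow n (column ((a , b) ∷ xs))     ≡⟨ sumBelow-cong n (λ {j} _ → column-∷ b xs j a<3) ⟩
  sumBelow n (λ j → δ j b + column xs j) ≡⟨ sumBelow-δ (column xs) b<n ⟩
  suc (sumBelow n (column xs))           ≡⟨ cong suc (sumBelow-column xs xs∈) ⟩
  suc (length xs)                        ∎
  where open ≡-Reasoning

isTee : Tile → ℕ
isTee (mono _)    = 0
isTee (tee _ _ _) = 1

teeCount : List Tile → ℕ
teeCount []       = 0
teeCount (t ∷ ts) = isTee t + teeCount ts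

length-cells : ∀ ts → length (concatMap cells ts) ≡ teeCount ts * 4 + monoCount ts
length-cells [] = refl
length-cells (mono _ ∷ ts) = trans (cong suc (length-cells ts)) (sym (+-suc _ _))
length-cells (tee down _ _ ∷ ts) = cong (4 +_) (length-cells ts)
length-cells (tee up _ _ ∷ ts) = cong (4 +_) (length-cells ts)
length-cells (tee right _ _ ∷ ts) = cong (4 +_) (length-cells ts)
length-cells (tee left _ _ ∷ ts) = cong (4 +_) (length-cells ts)

-- Starting columns of the tetrominoes.

startsIn : ℕ → Tile → ℕ
startsIn c (mono _)     = 0
startsIn c (tee _ _ c′) = δ c c′

starts : List Tile → ℕ → ℕ
starts []       c = 0
starts (t ∷ ts) c = startsIn c t + starts ts c

Shape : Set
Shape = Orientation × ℕ

place : Shape → ℕ → Tile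
place (o , r) c = tee o r c

shapes : List Shape
shapes = (down , 0) ∷ (down , 1) ∷ (up , 0) ∷ (up , 1) ∷ (right , 0) ∷ (left , 0) ∷ []

-- A horizontal tetromino has height two and an upright one height three, which leaves six shapes.
-- The column bound is the one common to all of them: the upright ones end in column `suc c`.
tee-inside : ∀ {n} o r c → All (InRect 3 n) (cells (tee o r c)) → (o , r) ∈ shapes × suc c < n
tee-inside down 0 c ((_ , _) ∷ (_ , p) ∷ _) = here refl , p
tee-inside down 1 c ((_ , _) ∷ (_ , p) ∷ _) = there (here refl) , p
tee-inside down (suc (suc r)) c (_ ∷ _ ∷ _ ∷ (s≤s (s≤s (s≤s ())) , _) ∷ _)
tee-inside up 0 c ((_ , _) ∷ (_ , p) ∷ _) = there (there (here refl)) , p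
tee-inside up 1 c ((_ , _) ∷ (_ , p) ∷ _) = there (there (there (here refl))) , p
tee-inside up (suc (suc r)) c ((s≤s (s≤s (s≤s ())) , _) ∷ _)
tee-inside right 0 c (_ ∷ _ ∷ _ ∷ (_ , p) ∷ _) = there (there (there (there (here refl)))) , p
tee-inside right (suc r) c (_ ∷ _ ∷ (s≤s (s≤s (s≤s ())) , _) ∷ _)
tee-inside left 0 c (_ ∷ (_ , p) ∷ _) = there (there (there (there (there (here refl))))) , p
tee-inside left (suc r) c (_ ∷ _ ∷ (s≤s (s≤s (s≤s ())) , _) ∷ _)

sumBelow-starts : ∀ {n} ts → Inside n ts → sumBelow n (starts ts) ≡ teeCount ts
sumBelow-starts {n} [] [] = trans (sumBelow-const n 0) (*-zeroʳ n)
sumBelow-starts (mono _ ∷ ts) (_ ∷ ts∈) = sumBelow-starts ts ts∈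
sumBelow-starts (tee o r c ∷ ts) (t∈ ∷ ts∈) = trans
  (sumBelow-δ (starts ts) (<-trans (n<1+n c) (proj₂ (tee-inside o r c t∈))))
  (cong suc (sumBelow-starts ts ts∈))

-- Covers the case in which column `suc c` lies outside the strip, where `partition` says nothing.
starts-outside : ∀ {n c} ts → Inside n ts → n ≤ suc c → starts ts c ≡ 0
starts-outside [] [] n≤ = refl
starts-outside (mono _ ∷ ts) (_ ∷ ts∈) n≤ = starts-outside ts ts∈ n≤
starts-outside {c = c} (tee o r c′ ∷ ts) (t∈ ∷ ts∈) n≤ = cong₂ _+_
  (δ-≢ λ c≡c′ → <⇒≢ (s≤s⁻¹ (<-≤-trans (proj₂ (tee-inside o r c′ t∈)) n≤)) (sym c≡c′))
  (starts-outside ts ts∈ n≤)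

count-place : ∀ i j k p c →
  count (i , j + c) (cells (place p (k + c))) ≡ count (i , j) (cells (place p k))
count-place i j k p c = trans
  (cong (count (i , j + c)) (cells-shift c (place p k)))
  (count-shift c i j (cells (place p k)))

-- The cell `(1 , 1)` is the stem or the middle of the bar in all six shapes. Hence two tetrominoes
-- starting in the same column would overlap.
covers-centre : All (λ p → count (1 , 1) (cells (place p 0)) ≡ 1) shapes
covers-centre = refl ∷ refl ∷ refl ∷ refl ∷ refl ∷ refl ∷ []

startsIn≤count : ∀ {n} c t → All (InRect 3 n) (cells t) → startsIn c t ≤ count (1 , suc c) (cells t)
startsIn≤count c (mono _) _ = z≤n
startsIn≤count c (tee o r c′) t∈ with c ≟ c′
... | no c≢c′ rewrite δ-≢ c≢c′ = z≤n
... | yes refl rewrite δ-refl c = ≤-reflexive (sym (trans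
  (count-place 1 1 0 (o , r) c)
  (All.lookup covers-centre (proj₁ (tee-inside o r c t∈)))))

starts≤count : ∀ {n} c ts → Inside n ts → starts ts c ≤ count (1 , suc c) (concatMap cells ts)
starts≤count c [] [] = z≤n
starts≤count c (t ∷ ts) (t∈ ∷ ts∈) rewrite count-++ (1 , suc c) (cells t) (concatMap cells ts) =
  +-mono-≤ (startsIn≤count c t t∈) (starts≤count c ts ts∈)

count-∈ : ∀ {t ts} x → t ∈ ts → count x (cells t) ≤ count x (concatMap cells ts)
count-∈ {t} {ts = u ∷ ts} x t∈ rewrite count-++ x (cells u) (concatMap cells ts) with t∈
... | here refl = m≤m+n _ _
... | there t∈′ = m≤n⇒m≤o+n (count x (cells u)) (count-∈ x t∈′)

-- Distinct tiles occupy distinct positions in the list, so their contributions add up.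
count-∈₂ : ∀ {t u ts} x → t ≢ u → t ∈ ts → u ∈ ts →
  count x (cells t) + count x (cells u) ≤ count x (concatMap cells ts)
count-∈₂ {ts = v ∷ ts} x t≢u t∈ u∈ rewrite count-++ x (cells v) (concatMap cells ts) with t∈ | u∈
... | here refl | here refl = contradiction refl t≢u
... | here refl | there u∈′ = +-monoʳ-≤ _ (count-∈ x u∈′)
... | there t∈′ | here refl = ≤-trans (≤-reflexive (+-comm _ (count x (cells v)))) (+-monoʳ-≤ _ (count-∈ x t∈′))
... | there t∈′ | there u∈′ = m≤n⇒m≤o+n (count x (cells v)) (count-∈₂ x t≢u t∈′ u∈′)

-- Words of slots and the potential.

Slot : Set
Slot = Maybe Shape

-- Slot k holds the tetromino starting in column k - 2; the empty slots 0 and 1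
-- give every column two predecessors.
slot : List Tile → ℕ → Slot
slot [] k = nothing
slot (mono _ ∷ ts) k = slot ts k
slot (tee o r c ∷ ts) k with k ≟ 2 + c
... | yes _ = just (o , r)
... | no _  = slot ts k

slot-just : ∀ {p} ts k → slot ts k ≡ just p → ∃ λ c → k ≡ 2 + c × place p c ∈ ts
slot-just (mono _ ∷ ts) k eq with slot-just ts k eq
... | c , k≡ , ∈ts = c , k≡ , there ∈ts
slot-just (tee o r c ∷ ts) k eq with k ≟ 2 + c
slot-just (tee o r c ∷ ts) k refl | yes k≡ = c , k≡ , here refl
... | no _ with slot-just ts k eq
...   | c′ , k≡ , ∈ts = c′ , k≡ , there ∈ts

slot-nothing : ∀ ts c → slot ts (2 + c) ≡ nothing → starts ts c ≡ 0
slot-nothing [] c eq = refl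
slot-nothing (mono _ ∷ ts) c eq = slot-nothing ts c eq
slot-nothing (tee o r c′ ∷ ts) c eq with 2 + c ≟ 2 + c′
slot-nothing (tee o r c′ ∷ ts) c () | yes _
... | no 2+c≢2+c′ = cong₂ _+_ (δ-≢ λ c≡c′ → 2+c≢2+c′ (cong (2 +_) c≡c′)) (slot-nothing ts c eq)

weight : Slot → ℕ
weight nothing  = 0
weight (just _) = 1

slots : List Slot
slots = nothing ∷ map just shapes

-- A shared cell is in particular a cell of the first shape, so testing those cells decides
-- disjointness. `d` is the distance between the starting columns.
Compatible : ℕ → Slot → Slot → Set
Compatible d nothing  _        = ⊤
Compatible d (just _) nothing  = ⊤
Compatible d (just p) (just q) =
  All (λ x → count x (cells (place p 0)) + count x (cells (place q d)) ≤ 1) (cells (place p 0))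

compatible? : ∀ d a b → Dec (Compatible d a b)
compatible? d nothing  _        = yes tt
compatible? d (just _) nothing  = yes tt
compatible? d (just p) (just q) = all? (λ x → _ ≤? 1) (cells (place p 0))

horizontal : Slot → ℕ
horizontal (just (down , _)) = 1
horizontal (just (up   , _)) = 1
horizontal _                 = 0

-- An upper bound for 3t - 2k, where t tetrominoes start in the first k columns
-- and a, b are the last two slots.
potential : Slot → Slot → ℕ
potential a nothing            = horizontal a
potential a (just (right , _)) = 1
potential a (just _)           = 2 + horizontal a

-- Tetrominoes are at most three columns wide, so a new letter can collide only with the two letters
-- before it.
Step : Slot → Slot → Slot → Set
Step a b c = Compatible 1 a b → Compatible 1 b c → Compatible 2 a c →
  3 * weight c + potential a b ≤ 2 + potential b c

step? : ∀ a b c → Dec (Step a b c)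
step? a b c = compatible? 1 a b →-dec compatible? 1 b c →-dec compatible? 2 a c →-dec _ ≤? _

-- A check of all triples of the seven slots. Among the triples ruled out by overlap are three
-- horizontal tetrominoes in a row and a horizontal one crossing the full column of an upright one.
-- Along the period `d u _` the potential runs through 2, 3, 1 and every step is an equality.
steps : All (λ a → All (λ b → All (Step a b) slots) slots) slots
steps = from-yes (all? (λ a → all? (λ b → all? (step? a b) slots) slots) slots)

-- At most two tetrominoes per three columns.

module LowerBound {n} (T : Tiling 3 n) where
  open Tiling T renaming (tiles to ts)

  T-count : ℕ
  T-count = teeCount ts

  area : 4 * T-count + monoCount ts ≡ 3 * n
  area = begin
    4 * T-count + monoCount ts                ≡⟨ cong (_+ monoCount ts) (*-comm 4 T-count) ⟩
    T-count * 4 + monoCount ts                ≡⟨ length-cells ts ⟨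
    length (concatMap cells ts)               ≡⟨ sumBelow-column _ (concat⁺ (map⁺ inside)) ⟨
    sumBelow n (column (concatMap cells ts))  ≡⟨ sumBelow-cong n (λ {j} j<n →
      cong₂ _+_ (partition 0 j 0<1+n j<n)
        (cong₂ _+_ (partition 1 j (s≤s 0<1+n) j<n) (partition 2 j ≤-refl j<n))) ⟩
    sumBelow n (λ _ → 3)                      ≡⟨ sumBelow-const n 3 ⟩
    n * 3                                     ≡⟨ *-comm n 3 ⟩
    3 * n                                     ∎
    where open ≡-Reasoning

  s : ℕ → Slot
  s = slot ts

  -- `slot` records only the first tetromino listed for a column; nothing is lost, since inside the
  -- strip the cell `(1 , suc c)` is covered once.
  starts≤weight : ∀ c → starts ts c ≤ weight (s (2 + c))
  starts≤weight c with slot ts (2 + c) in eq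
  ... | nothing = ≤-reflexive (slot-nothing ts c eq)
  ... | just _ with <-≤-connex (suc c) n
  ...   | inj₁ c<n = ≤-trans (starts≤count c ts inside) (≤-reflexive (partition 1 (suc c) (s≤s 0<1+n) c<n))
  ...   | inj₂ n≤c = ≤-trans (≤-reflexive (starts-outside ts inside n≤c)) z≤n

  s-inside : ∀ {p} k → s k ≡ just p → ∃ λ c → k ≡ 2 + c × place p c ∈ ts × All (InRect 3 n) (cells (place p c))
  s-inside k eq with slot-just ts k eq
  ... | c , k≡ , ∈ts = c , k≡ , ∈ts , All.lookup inside ∈ts

  s∈slots : ∀ k → s k ∈ slots
  s∈slots k with slot ts k in eq
  ... | nothing = here refl
  ... | just (o , r) with s-inside k eq
  ...   | c , _ , _ , t∈ = there (∈-map⁺ just (proj₁ (tee-inside o r c t∈)))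

  -- Translates the overlap test back to the actual columns, where `partition` gives each cell a
  -- single tile.
  s-compatible : ∀ d k → Compatible (suc d) (s k) (s (suc d + k))
  s-compatible d k with slot ts k in eq₁ | slot ts (suc d + k) in eq₂
  ... | nothing | _       = tt
  ... | just _  | nothing = tt
  ... | just p  | just q with s-inside k eq₁ | s-inside (suc d + k) eq₂
  ...   | c , refl , p∈ , p-inside | c′ , k≡ , q∈ , _ = All.tabulate disjoint
    where
    c′≡ : c′ ≡ suc d + c
    c′≡ = suc-injective (suc-injective (trans (sym k≡) (lemma d c)))
      where lemma : ∀ d c → suc d + (2 + c) ≡ 2 + (suc d + c)
            lemma = solve-∀
    q∈′ : place q (suc d + c) ∈ ts
    q∈′ = subst (λ m → place q m ∈ ts) c′≡ q∈
    p≢q : place p c ≢ place q (suc d + c)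
    p≢q eq = <⇒≢ (s≤s (m≤n+m c d)) (cong col eq)
      where col : Tile → ℕ
            col (mono _)    = 0
            col (tee _ _ m) = m
    disjoint : ∀ {x} → x ∈ cells (place p 0) →
      count x (cells (place p 0)) + count x (cells (place q (suc d))) ≤ 1
    disjoint {i , j} x∈ = begin
      count (i , j) (cells (place p 0)) + count (i , j) (cells (place q (suc d)))
        ≡⟨ cong₂ _+_ (count-place i j 0 p c) (count-place i j (suc d) q c) ⟨
      count (i , j + c) (cells (place p c)) + count (i , j + c) (cells (place q (suc d + c)))
        ≤⟨ count-∈₂ (i , j + c) p≢q p∈ q∈′ ⟩
      count (i , j + c) (concatMap cells ts)
        ≡⟨ partition i (j + c) (proj₁ x-inside) (proj₂ x-inside) ⟩
      1 ∎
      where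
      open ≤-Reasoning
      x-inside : InRect 3 n (i , j + c)
      x-inside = All.lookup p-inside
        (subst ((i , j + c) ∈_) (sym (cells-shift c (place p 0))) (∈-map⁺ (shiftCell c) x∈))

  s-step : ∀ k → 3 * weight (s (2 + k)) + potential (s k) (s (1 + k)) ≤ 2 + potential (s (1 + k)) (s (2 + k))
  s-step k = All.lookup (All.lookup (All.lookup steps (s∈slots k)) (s∈slots (1 + k))) (s∈slots (2 + k))
    (s-compatible 0 k) (s-compatible 0 (1 + k)) (s-compatible 1 k)

  -- Telescopes `s-step`; the start needs only that the potential is nonnegative.
  prefix : ∀ k → 3 * sumBelow k (λ c → weight (s (2 + c))) ≤ 2 * k + potential (s k) (s (1 + k))
  prefix zero = z≤n
  prefix (suc k) = begin
    3 * (w + W)                       ≡⟨ *-distribˡ-+ 3 w W ⟩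
    3 * w + 3 * W                     ≤⟨ +-monoʳ-≤ (3 * w) (prefix k) ⟩
    3 * w + (2 * k + f)               ≡⟨ l₁ (3 * w) (2 * k) f ⟩
    2 * k + (3 * w + f)               ≤⟨ +-monoʳ-≤ (2 * k) (s-step k) ⟩
    2 * k + (2 + f′)                  ≡⟨ l₂ k f′ ⟩
    2 * suc k + f′                    ∎
    where
    open ≤-Reasoning
    w  = weight (s (2 + k))
    W  = sumBelow k (λ c → weight (s (2 + c)))
    f  = potential (s k) (s (1 + k))
    f′ = potential (s (1 + k)) (s (2 + k))
    l₁ : ∀ x y z → x + (y + z) ≡ y + (x + z)
    l₁ = solve-∀
    l₂ : ∀ k f → 2 * k + (2 + f) ≡ 2 * suc k + f
    l₂ = solve-∀

  -- Slot `1 + n` stands for column `n - 1`, where even an upright tetromino would stick out.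
  end₁ : s (1 + n) ≡ nothing
  end₁ with slot ts (1 + n) in eq
  ... | nothing = refl
  ... | just (o , r) with s-inside (1 + n) eq
  ...   | c , refl , _ , t∈ = contradiction (proj₂ (tee-inside o r c t∈)) (n≮n (suc c))

  -- Slot `n` stands for column `n - 2`, where only an upright tetromino fits; the bar of a
  -- horizontal one would end in column `n`.
  end₀ : horizontal (s n) ≡ 0
  end₀ with slot ts n in eq
  ... | nothing          = refl
  ... | just (right , _) = refl
  ... | just (left , _)  = refl
  ... | just (down , _) with s-inside n eq
  ...   | c , refl , _ , (_ ∷ _ ∷ (_ , c<n) ∷ _) = contradiction c<n (n≮n n)
  end₀ | just (up , _) with s-inside n eq
  ...   | c , refl , _ , (_ ∷ _ ∷ (_ , c<n) ∷ _) = contradiction c<n (n≮n n)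

  3T≤2n : 3 * T-count ≤ 2 * n
  3T≤2n = begin
    3 * T-count                                   ≡⟨ cong (3 *_) (sumBelow-starts ts inside) ⟨
    3 * sumBelow n (starts ts)                    ≤⟨ *-monoʳ-≤ 3 (sumBelow-≤ n (λ {c} _ → starts≤weight c)) ⟩
    3 * sumBelow n (λ c → weight (s (2 + c)))     ≤⟨ prefix n ⟩
    2 * n + potential (s n) (s (1 + n))           ≡⟨ cong (λ x → 2 * n + potential (s n) x) end₁ ⟩
    2 * n + horizontal (s n)                      ≡⟨ cong (2 * n +_) end₀ ⟩
    2 * n + 0                                     ≡⟨ +-identityʳ (2 * n) ⟩
    2 * n                                         ∎
    where open ≤-Reasoning

  -- By `area`, each tetromino fewer frees four cells for monominoes.
  monos-≥ : ∀ a k → T-count ≤ a → 3 * n ≡ 4 * a + k → k ≤ monominos T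
  monos-≥ a k t≤a 3n≡ = +-cancelˡ-≤ (4 * a) k _ (begin
    4 * a + k                  ≡⟨ 3n≡ ⟨
    3 * n                      ≡⟨ area ⟨
    4 * T-count + monominos T  ≤⟨ +-monoˡ-≤ _ (*-monoʳ-≤ 4 t≤a) ⟩
    4 * a + monominos T        ∎)
    where open ≤-Reasoning

  T-count-≤ : ∀ a → 2 * n < 3 * suc a → T-count ≤ a
  T-count-≤ a 2n< = s≤s⁻¹ (*-cancelˡ-< 3 _ _ (≤-<-trans 3T≤2n 2n<))

-- The square of side three.

tee-covers-centre : All (λ c → All (λ p → All (InRect 3 3) (cells (place p c)) →
  1 ≤ count (1 , 1) (cells (place p c))) shapes) (0 ∷ 1 ∷ [])
tee-covers-centre = from-yes (all? (λ c → all? (λ p →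
  fits? 3 (place p c) →-dec 1 ≤? count (1 , 1) (cells (place p c))) shapes) (0 ∷ 1 ∷ []))

-- From column 0 every shape reaches the centre; in column 1 only upright tetrominoes fit, and these
-- contain it as well. So one tetromino is possible where the general bound allows two.
teeCount≤centre : ∀ ts → Inside 3 ts → teeCount ts ≤ count (1 , 1) (concatMap cells ts)
teeCount≤centre [] [] = z≤n
teeCount≤centre (t ∷ ts) (t∈ ∷ ts∈) rewrite count-++ (1 , 1) (cells t) (concatMap cells ts) =
  +-mono-≤ (one t t∈) (teeCount≤centre ts ts∈)
  where
  below-2 : ∀ {c} → suc c < 3 → c ∈ 0 ∷ 1 ∷ []
  below-2 {0} _ = here refl
  below-2 {1} _ = there (here refl)
  below-2 {suc (suc _)} (s≤s (s≤s (s≤s ())))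
  one : ∀ t → All (InRect 3 3) (cells t) → isTee t ≤ count (1 , 1) (cells t)
  one (mono _)    _  = z≤n
  one (tee o r c) t∈ with tee-inside o r c t∈
  ... | p∈ , c< = All.lookup (All.lookup tee-covers-centre (below-2 c<)) p∈ t∈

gap-3 : GapNumberIs 3 3 5
gap-3 = toTiling (partial 3 []
          (tee down 0 0 ∷ mono (1 , 0) ∷ mono (1 , 2) ∷ mono (2 , 0) ∷ mono (2 , 1) ∷ mono (2 , 2) ∷ []))
      , λ T → let open Tiling T in LowerBound.monos-≥ T 1 5
          (≤-trans (teeCount≤centre tiles inside) (≤-reflexive (partition 1 1 (from-yes (1 <? 3)) (from-yes (1 <? 3))))) refl

-- The residue classes modulo three.

gap-3q : ∀ q → 1 ≤ q → q ≢ 1 → GapNumberIs 3 (q * 3) q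
gap-3q 0 () _
gap-3q 1 _ q≢1 = contradiction refl q≢1
-- One column for the opening tetromino and `2 + suc q′ * 3` for the rest make `q * 3`; the block
-- that `capped` always contains forces `q` to be at least 2.
gap-3q q@(suc (suc q′)) _ _ = toTiling (afterUpright (capped q′))
  , λ T → let open LowerBound T in
      -- Here `2 * n` is `6 * q`, so `2 * n < 3 * suc (2 * q)` holds with slack 2.
      monos-≥ (2 * q) q (T-count-≤ (2 * q) (≤-trans (m≤n+m _ 2) (≤-reflexive (l₁ q)))) (l₂ q)
  where
  l₁ : ∀ q → 2 + suc (2 * (q * 3)) ≡ 3 * suc (2 * q)
  l₁ = solve-∀
  l₂ : ∀ q → 3 * (q * 3) ≡ 4 * (2 * q) + q
  l₂ = solve-∀

gap-3q+1 : ∀ q → GapNumberIs 3 (1 + q * 3) (q + 3)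
gap-3q+1 q = subst (λ k → Σ (Tiling 3 (1 + q * 3)) λ T → monominos T ≡ k) (+-comm 3 q)
      (toTiling (fillBottom (fillCentre (blunt q))))
  , λ T → let open LowerBound T in
      monos-≥ (2 * q) (q + 3) (T-count-≤ (2 * q) (≤-reflexive (l₁ q))) (l₂ q)
  where
  l₁ : ∀ q → suc (2 * (1 + q * 3)) ≡ 3 * suc (2 * q)
  l₁ = solve-∀
  l₂ : ∀ q → 3 * (1 + q * 3) ≡ 4 * (2 * q) + (q + 3)
  l₂ = solve-∀

gap-3q+2 : ∀ q → GapNumberIs 3 (2 + q * 3) (q + 2)
gap-3q+2 q = subst (λ k → Σ (Tiling 3 (2 + q * 3)) λ T → monominos T ≡ k) (+-comm 2 q)
      (toTiling (afterUpright (blunt q)))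
  , λ T → let open LowerBound T in
      -- Here `2 * n` is `6 * q + 4`, and a third of it rounds down to `2 * q + 1`.
      monos-≥ (2 * q + 1) (q + 2) (T-count-≤ (2 * q + 1) (≤-trans (m≤n+m _ 1) (≤-reflexive (l₁ q)))) (l₂ q)
  where
  l₁ : ∀ q → 1 + suc (2 * (2 + q * 3)) ≡ 3 * suc (2 * q + 1)
  l₁ = solve-∀
  l₂ : ∀ q → 3 * (2 + q * 3) ≡ 4 * (2 * q + 1) + (q + 2)
  l₂ = solve-∀

divide : ∀ n {r} → n % 3 ≡ r → n ≡ r + n / 3 * 3
divide n n%3≡r = trans (m≡m%n+[m/n]*n n 3) (cong (_+ n / 3 * 3) n%3≡r)

theorem1 : ∀ (n : ℕ) → 1 ≤ n →
    (n ≡ 3 → GapNumberIs 3 n 5) ×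
    (n % 3 ≡ 0 → n ≢ 3 → GapNumberIs 3 n (n / 3)) ×
    (n % 3 ≡ 1 → GapNumberIs 3 n (n / 3 + 3)) ×
    (n % 3 ≡ 2 → GapNumberIs 3 n (n / 3 + 2))
theorem1 n 1≤n = (λ { refl → gap-3 }) , case₀ , case₁ , case₂
  where
  q = n / 3

  case₀ : n % 3 ≡ 0 → n ≢ 3 → GapNumberIs 3 n q
  case₀ r n≢3 = subst (λ m → GapNumberIs 3 m q) (sym n≡)
    (gap-3q q (n≢0⇒n>0 λ q≡0 → <⇒≢ 1≤n (sym (trans n≡ (cong (_* 3) q≡0))))
              (λ q≡1 → n≢3 (trans n≡ (cong (_* 3) q≡1))))
    where
    n≡ : n ≡ q * 3
    n≡ = divide n r

  case₁ : n % 3 ≡ 1 → GapNumberIs 3 n (q + 3)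
  case₁ r = subst (λ m → GapNumberIs 3 m (q + 3)) (sym (divide n r)) (gap-3q+1 q)

  case₂ : n % 3 ≡ 2 → GapNumberIs 3 n (q + 2)
  case₂ r = subst (λ m → GapNumberIs 3 m (q + 2)) (sym (divide n r)) (gap-3q+2 q)
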